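{- The order type of the well-ordered set $\mathcal{F}$ of fusible numbers (ordered as a subset of $\mathbb{R}$) is at least $\varepsilon_0$.
   Context: The fuse operation is the partial binary operation on real numbers $a\sim b=(a+b+1)/2$, applicable only when $|a-b|<1$. A fusible number is a real number obtainable from $0$ by finitely many (valid) applications of the fuse operation; i.e. the set $\mathcal{F}$ of fusible numbers is the smallest subset of $\mathbb{R}$ such that $0\in\mathcal{F}$ and, whenever $a,b\in\mathcal{F}$ and $|a-b|<1$, also $(a+b+1)/2\in\mathcal{F}$. The set $\mathcal{F}$ is well-ordered by the usual order of $\mathbb{R}$. The ordinal $\varepsilon_0$ is $\sup\{\omega,\omega^\omega,\omega^{\omega^\omega},\dots\}$. -}

module Defs where

open import Data.Nat.Base using (ℕ; zero; suc)
open import Data.Product.Base using (Σ; ∃; _,_; proj₁)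
open import Data.Rational.Base using (ℚ; 0ℚ; 1ℚ; ½; _+_; _-_; _*_; ∣_∣)
  renaming (_<_ to _<ℚ_)
open import Data.Rational.Properties using () renaming (<-strictTotalOrder to ℚ-strictTotalOrder)
open import Data.Sum.Base using (_⊎_)
open import Level using (Level; 0ℓ; _⊔_)
open import Relation.Binary.Bundles using (StrictTotalOrder)
open import Relation.Binary.Definitions using (Transitive; Trichotomous; tri<; tri≈; tri>)
open import Relation.Binary.Morphism.Structures using (IsOrderMonomorphism)
open import Relation.Binary.PropositionalEquality.Core using (_≡_; refl)
open import Relation.Binary.PropositionalEquality.Properties using (isEquivalence)
open import Relation.Binary.Structures.Biased using (isStrictTotalOrderᶜ)
import Relation.Binary.Construct.On as On

private
  variable
    a₁ a₂ a₃ b₁ b₂ b₃ : Level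

-- Every number obtainable from 0 by fusing is rational, so 𝓕 is generated
-- inside ℚ; its order as a subset of ℝ is its order as a subset of ℚ.

data Fusible : ℚ → Set where
  base : Fusible 0ℚ
  fuse : ∀ {a b} → Fusible a → Fusible b → ∣ a - b ∣ <ℚ 1ℚ →
         Fusible ((a + b + 1ℚ) * ½)

-- Elements of ∃ Fusible are compared, also for equality, by their values only:
-- different derivations of the same number are identified.

𝓕 : StrictTotalOrder 0ℓ 0ℓ 0ℓ
𝓕 = On.strictTotalOrder ℚ-strictTotalOrder (proj₁ {B = Fusible})

-- The ordinals below ε₀ are represented by their (hereditary) Cantor normal
-- forms ω^ α₁ ∔ (ω^ α₂ ∔ (… ∔ 𝟎)) with α₁ ≥ α₂ ≥ … .

infixr 6 ω^_∔_
infix  4 _≺_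

data Term : Set where
  𝟎     : Term
  ω^_∔_ : Term → Term → Term

data _≺_ : Term → Term → Set where
  𝟎≺   : ∀ {α β}     → 𝟎 ≺ ω^ α ∔ β
  head : ∀ {α β γ δ} → α ≺ γ → ω^ α ∔ β ≺ ω^ γ ∔ δ
  tail : ∀ {α β δ}   → β ≺ δ → ω^ α ∔ β ≺ ω^ α ∔ δ

data CNF : Term → Set where
  nil    : CNF 𝟎
  single : ∀ {α} → CNF α → CNF (ω^ α ∔ 𝟎)
  cons   : ∀ {α β γ} → CNF α → CNF (ω^ β ∔ γ) → β ≺ α ⊎ β ≡ α →
           CNF (ω^ α ∔ (ω^ β ∔ γ))

≺-trans : Transitive _≺_
≺-trans 𝟎≺       (head _) = 𝟎≺
≺-trans 𝟎≺       (tail _) = 𝟎≺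
≺-trans (head p) (head q) = head (≺-trans p q)
≺-trans (head p) (tail _) = head p
≺-trans (tail _) (head q) = head q
≺-trans (tail p) (tail q) = tail (≺-trans p q)

≺-cmp : Trichotomous _≡_ _≺_
≺-cmp 𝟎          𝟎          = tri≈ (λ ()) refl (λ ())
≺-cmp 𝟎          (ω^ _ ∔ _) = tri< 𝟎≺ (λ ()) (λ ())
≺-cmp (ω^ _ ∔ _) 𝟎          = tri> (λ ()) (λ ()) 𝟎≺
≺-cmp (ω^ α ∔ β) (ω^ γ ∔ δ) with ≺-cmp α γ
... | tri< p ≢ ≯ = tri< (head p) (λ { refl → ≢ refl })
                        (λ { (head q) → ≯ q ; (tail _) → ≢ refl })
... | tri> ≮ ≢ p = tri> (λ { (head q) → ≮ q ; (tail _) → ≢ refl })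
                        (λ { refl → ≢ refl }) (head p)
... | tri≈ ≮ refl ≯ with ≺-cmp β δ
...   | tri< p ≢ ≯′ = tri< (tail p) (λ { refl → ≢ refl })
                           (λ { (head q) → ≯ q ; (tail q) → ≯′ q })
...   | tri≈ ≮′ refl ≯′ = tri≈ (λ { (head q) → ≮ q ; (tail q) → ≮′ q }) refl
                               (λ { (head q) → ≯ q ; (tail q) → ≯′ q })
...   | tri> ≮′ ≢ p = tri> (λ { (head q) → ≮ q ; (tail q) → ≮′ q })
                           (λ { refl → ≢ refl }) (tail p)

Term-strictTotalOrder : StrictTotalOrder 0ℓ 0ℓ 0ℓ
Term-strictTotalOrder = record
  { isStrictTotalOrder = isStrictTotalOrderᶜ record
    { isEquivalence = isEquivalence
    ; trans         = ≺-trans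
    ; compare       = ≺-cmp
    }
  }

-- As a well-ordered set, the ordinal ε₀ is the set of the ordinals below it.

ε₀ : StrictTotalOrder 0ℓ 0ℓ 0ℓ
ε₀ = On.strictTotalOrder Term-strictTotalOrder (proj₁ {B = CNF})

-- ω, ω^ω, ω^ω^ω, …  The two lemmas below say that these are Cantor normal
-- forms and that every term lies below one of them: ε₀ is their supremum.

tower : ℕ → Term
tower zero    = ω^ (ω^ 𝟎 ∔ 𝟎) ∔ 𝟎
tower (suc n) = ω^ tower n ∔ 𝟎

tower-CNF : ∀ n → CNF (tower n)
tower-CNF zero    = single (single nil)
tower-CNF (suc n) = single (tower-CNF n)

tower-cofinal : ∀ α → ∃ λ n → α ≺ tower n
tower-cofinal 𝟎          = zero , 𝟎≺
tower-cofinal (ω^ α ∔ _) with tower-cofinal α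
... | n , α≺ = suc n , head α≺

-- The order type of A is at most that of B: A is isomorphic, as an ordered
-- set, to a subset of B.  (For well-ordered A and B this is the order of the
-- ordinals that are their order types.)

infix 4 _≼_

_≼_ : StrictTotalOrder a₁ a₂ a₃ → StrictTotalOrder b₁ b₂ b₃ →
      Set (a₁ ⊔ a₂ ⊔ a₃ ⊔ b₁ ⊔ b₂ ⊔ b₃)
A ≼ B = Σ (A.Carrier → B.Carrier) (IsOrderMonomorphism A._≈_ B._≈_ A._<_ B._<_)
  where
  module A = StrictTotalOrder A
  module B = StrictTotalOrder B

{-# OPTIONS --safe #-}

-- For a fusible s, fusing with s halves the distance to s + 1.  By induction
-- on n, the normal forms of height at most n are embedded into the fusible
-- numbers in [n , n + 1).  If β already sits at s, the elements ω^ β ∔ ρ of the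
-- next level are obtained from those for ρ by fusing with s so often that
-- everything between s and s + 1 ends up closer to s + 1 than the gap below s.
-- Then all ω^ β ∔ ρ lie below s + 1, but above s′ + 1 for all s′ belonging to
-- smaller exponents.

module Submission where

open import Defs

open import Data.Nat.Base as ℕ using (ℕ; zero; suc; z≤n; s≤s)
import Data.Nat.Properties as ℕₚ
open import Data.Product.Base using (_,_)
open import Data.Rational.Base using (ℚ; 0ℚ; 1ℚ; ½; _+_; _-_; _*_; ∣_∣; _≤_; _<_)
open import Data.Rational.Properties
  using (≤-refl; ≤-reflexive; ≤-trans; <⇒≤; <-trans; <-≤-trans; positive⁻¹; nonNegative⁻¹;
         +-mono-≤; +-monoˡ-≤; +-monoˡ-<; +-monoʳ-<; *-monoʳ-≤-nonNeg; *-monoˡ-<-pos; 0≤p⇒∣p∣≡p)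
open import Data.Rational.Solver using (module +-*-Solver)
open import Data.Sum.Base using (inj₁; inj₂)
open import Function.Base using (case_of_)
open import Relation.Binary.Bundles using (StrictTotalOrder)
open import Relation.Binary.Definitions using (tri<; tri≈; tri>)
open import Relation.Binary.PropositionalEquality
  using (_≡_; refl; sym; trans; cong; subst; subst₂)
open import Relation.Nullary.Negation using (contradiction)

open +-*-Solver using (solve; _:+_; _:-_; _:*_; _:=_; con)

-- Linear inequalities and powers of one half.

-- Since `q - p` equals `y - x`, a linear estimate is reduced to a ring identity, which the solver
-- can settle.
≤-shift : ∀ {x y p q} → x ≤ y → q ≡ y + (p - x) → p ≤ q
≤-shift {x} {y} {p} x≤y q≡ = subst₂ _≤_
  (solve 2 (λ x p → x :+ (p :- x) := p) refl x p) (sym q≡) (+-monoˡ-≤ (p - x) x≤y)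

<-shift : ∀ {x y p q} → x < y → q ≡ y + (p - x) → p < q
<-shift {x} {y} {p} x<y q≡ = subst₂ _<_
  (solve 2 (λ x p → x :+ (p :- x) := p) refl x p) (sym q≡) (+-monoˡ-< (p - x) x<y)

½^ : ℕ → ℚ
½^ zero    = 1ℚ
½^ (suc k) = ½^ k * ½

½^-positive : ∀ k → 0ℚ < ½^ k
½^-positive zero    = positive⁻¹ 1ℚ
½^-positive (suc k) = *-monoˡ-<-pos ½ (½^-positive k)

½^-suc-< : ∀ k → ½^ (suc k) < 1ℚ
½^-suc-< zero    = <-shift (positive⁻¹ ½) refl
½^-suc-< (suc k) = <-trans (*-monoˡ-<-pos ½ (½^-suc-< k)) (½^-suc-< zero)

½^-halves : ∀ k → ½^ (suc k) + ½^ (suc k) ≡ ½^ k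
½^-halves k = solve 1 (λ w → w :* con ½ :+ w :* con ½ := w) refl (½^ k)

gap⇒< : ∀ k {x y} → x + ½^ k ≤ y → x < y
gap⇒< k {x} gap = <-≤-trans
  (<-shift (½^-positive k) (solve 2 (λ x w → x :+ w := w :+ (x :- con 0ℚ)) refl x (½^ k)))
  gap

-- Fusing repeatedly with a fixed number.

infixl 6 _∼_

_∼_ : ℚ → ℚ → ℚ
a ∼ b = (a + b + 1ℚ) * ½

fuse-≤ : ∀ {a b} → Fusible a → Fusible b → b ≤ a → a < b + 1ℚ → Fusible (a ∼ b)
fuse-≤ {a} {b} fa fb b≤a a<b+1 = fuse fa fb
  (subst (_< 1ℚ) (sym (0≤p⇒∣p∣≡p
     (≤-shift b≤a (solve 2 (λ a b → a :- b := a :+ (con 0ℚ :- b)) refl a b))))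
  (<-shift a<b+1
     (solve 2 (λ a b → con 1ℚ := b :+ con 1ℚ :+ (a :- b :- a)) refl a b)))

approach : ℕ → ℚ → ℚ → ℚ
approach zero    s x = x
approach (suc k) s x = approach k s x ∼ s

approach-gap : ∀ k {j s x y} → x + ½^ j ≤ y →
               approach k s x + ½^ (k ℕ.+ j) ≤ approach k s y
approach-gap zero    gap = gap
approach-gap (suc k) {j} {s} {x} {y} gap = ≤-shift
  (*-monoʳ-≤-nonNeg ½ (approach-gap k {j} {s} gap))
  (solve 4 (λ x y s w →
     (y :+ s :+ con 1ℚ) :* con ½ :=
     y :* con ½ :+ ((x :+ s :+ con 1ℚ) :* con ½ :+ w :* con ½ :- (x :+ w) :* con ½))
   refl (approach k s x) (approach k s y) s (½^ (k ℕ.+ j)))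

approach-< : ∀ k {s x} → x < s + 1ℚ → approach k s x < s + 1ℚ
approach-< zero    x< = x<
approach-< (suc k) {s} {x} x< = <-shift
  (*-monoˡ-<-pos ½ (approach-< k {s} {x} x<))
  (solve 2 (λ x s →
     s :+ con 1ℚ :=
     (s :+ con 1ℚ) :* con ½ :+ ((x :+ s :+ con 1ℚ) :* con ½ :- x :* con ½))
   refl (approach k s x) s)

-- The distance from `s` to the fixed point `s + 1` is 1, and each of the `k` fusions halves it.
approach-self : ∀ k s → approach k s s + ½^ k ≡ s + 1ℚ
approach-self zero    s = refl
approach-self (suc k) s = trans
  (solve 3 (λ x s w →
     (x :+ s :+ con 1ℚ) :* con ½ :+ w :* con ½ :=
     (x :+ w) :* con ½ :+ (s :+ con 1ℚ) :* con ½)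
   refl (approach k s s) s (½^ k))
  (trans (cong (λ z → z * ½ + (s + 1ℚ) * ½) (approach-self k s))
    (solve 1 (λ s → (s :+ con 1ℚ) :* con ½ :+ (s :+ con 1ℚ) :* con ½ := s :+ con 1ℚ) refl s))

approach-≥ : ∀ k {s x} → s ≤ x → x < s + 1ℚ → s ≤ approach k s x
approach-≥ zero    s≤x _ = s≤x
approach-≥ (suc k) {s} {x} s≤x x< = ≤-shift
  (≤-trans (*-monoʳ-≤-nonNeg ½ (approach-≥ k s≤x x<))
    (≤-shift (nonNegative⁻¹ ½)
      (solve 1 (λ y → y :* con ½ :+ con ½ := con ½ :+ (y :* con ½ :- con 0ℚ)) refl (approach k s x))))
  (solve 2 (λ y s → (y :+ s :+ con 1ℚ) :* con ½ := y :* con ½ :+ con ½ :+ (s :- s :* con ½))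
   refl (approach k s x) s)

approach-fusible : ∀ k {s x} → Fusible s → Fusible x → s ≤ x → x < s + 1ℚ →
                   Fusible (approach k s x)
approach-fusible zero    fs fx s≤x x< = fx
approach-fusible (suc k) fs fx s≤x x< =
  fuse-≤ (approach-fusible k fs fx s≤x x<) fs (approach-≥ k s≤x x<) (approach-< k x<)

-- Integers and the lowest point of each level.

fromℕ : ℕ → ℚ
fromℕ zero    = 0ℚ
fromℕ (suc n) = fromℕ n + 1ℚ

fromℕ-mono : ∀ {m n} → m ℕ.≤ n → fromℕ m ≤ fromℕ n
fromℕ-mono {n = zero}  z≤n = ≤-refl
fromℕ-mono {n = suc n} z≤n = ≤-trans (fromℕ-mono {n = n} z≤n)
  (≤-shift (nonNegative⁻¹ 1ℚ) (solve 1 (λ x → x :+ con 1ℚ := con 1ℚ :+ (x :- con 0ℚ)) refl (fromℕ n)))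
fromℕ-mono (s≤s m≤n) = +-monoˡ-≤ 1ℚ (fromℕ-mono m≤n)

<-+1 : ∀ x → x < x + 1ℚ
<-+1 x = gap⇒< 0 ≤-refl

-- `x ∼ x` is `x + ½`, so two successive self-fusions add one.
suc-fusible : ∀ {x} → Fusible x → Fusible (x + 1ℚ)
suc-fusible {x} fx = subst Fusible
  (solve 1 (λ x → let y = (x :+ x :+ con 1ℚ) :* con ½ in
                  (y :+ y :+ con 1ℚ) :* con ½ := x :+ con 1ℚ) refl x)
  (fuse-≤ (double fx) (double fx) ≤-refl (<-+1 (x ∼ x)))
  where
  double : ∀ {x} → Fusible x → Fusible (x ∼ x)
  double {x} fx = fuse-≤ fx fx ≤-refl (<-+1 x)

fromℕ-fusible : ∀ n → Fusible (fromℕ n)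
fromℕ-fusible zero    = base
fromℕ-fusible (suc n) = suc-fusible (fromℕ-fusible n)

-- The numbers n + 2⁻ⁿ⁻¹ exceed the integer n, yet bottom (suc n) - 1 < bottom n.

bottom : ℕ → ℚ
bottom n = fromℕ n + ½^ (suc n)

fromℕ<bottom : ∀ n → fromℕ n < bottom n
fromℕ<bottom n = gap⇒< (suc n) ≤-refl

bottom-< : ∀ n → bottom n < fromℕ (suc n)
bottom-< n = +-monoʳ-< (fromℕ n) (½^-suc-< n)

bottom-fusible : ∀ n → Fusible (bottom n)
bottom-fusible zero    = fuse base base (positive⁻¹ 1ℚ)
bottom-fusible (suc n) = subst Fusible
  (solve 2 (λ x w → (x :+ con 1ℚ :+ (x :+ w) :+ con 1ℚ) :* con ½ := x :+ con 1ℚ :+ w :* con ½)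
   refl (fromℕ n) (½^ (suc n)))
  -- The integer `n + 1` is fused with `bottom n`. Their distance is below 1 because `bottom n`
  -- strictly exceeds `n`.
  (fuse-≤ (fromℕ-fusible (suc n)) (bottom-fusible n) (<⇒≤ (bottom-< n))
    (+-monoˡ-< 1ℚ (fromℕ<bottom n)))

-- Values of terms.

-- Only the leading exponent counts: in a normal form the later ones are not larger, hence by
-- `height-mono` no higher.
height : Term → ℕ
height 𝟎          = zero
height (ω^ α ∔ _) = suc (height α)

height-mono : ∀ {α β} → α ≺ β → height α ℕ.≤ height β
height-mono 𝟎≺       = z≤n
height-mono (head p) = s≤s (height-mono p)
height-mono (tail p) = ℕₚ.≤-refl

-- value n t is meant for height t ≤ n (other clauses are junk); it exceeds all
-- smaller values of level n by at least ½^ (gapExp n t).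

gapExp : ℕ → Term → ℕ
gapExp n       𝟎          = suc (suc n)
gapExp zero    (ω^ _ ∔ _) = zero
gapExp (suc n) (ω^ β ∔ ρ) = gapExp n β ℕ.+ gapExp (suc n) ρ

value : ℕ → Term → ℚ
value n       𝟎          = bottom n
value zero    (ω^ _ ∔ _) = 0ℚ
value (suc n) (ω^ β ∔ ρ) = approach (gapExp n β) (value n β) (value (suc n) ρ)

CNF-exponent : ∀ {β ρ} → CNF (ω^ β ∔ ρ) → CNF β
CNF-exponent (single cβ)   = cβ
CNF-exponent (cons cβ _ _) = cβ

CNF-rest : ∀ {β ρ} → CNF (ω^ β ∔ ρ) → CNF ρ
CNF-rest (single _)    = nil
CNF-rest (cons _ cρ _) = cρ

height-rest : ∀ {β ρ n} → CNF (ω^ β ∔ ρ) → height β ℕ.≤ n → height ρ ℕ.≤ suc n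
height-rest (single _)            h = z≤n
height-rest (cons _ _ (inj₁ γ≺β)) h = s≤s (ℕₚ.≤-trans (height-mono γ≺β) h)
height-rest (cons _ _ (inj₂ refl)) h = s≤s h

-- Bounds and gaps, by mutual induction on terms.

bottom-suc : ∀ n → bottom (suc n) + ½^ (suc (suc n)) ≡ bottom n + 1ℚ
bottom-suc n = trans
  (solve 2 (λ x w → x :+ con 1ℚ :+ w :+ w := x :+ (w :+ w) :+ con 1ℚ) refl (fromℕ n) (½^ (suc (suc n))))
  (cong (λ w → fromℕ n + w + 1ℚ) (½^-halves (suc n)))

-- Links two levels: `bottom (suc n)` is the value of `𝟎` one level up, and the margin below
-- `value n t + 1` is the one that `node-gap` asks for.
value-lower : ∀ {n t} → CNF t → height t ℕ.≤ n →
              bottom (suc n) + ½^ (gapExp n t) ≤ value n t + 1ℚ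
value-upper : ∀ {n t} → CNF t → height t ℕ.≤ n → value n t < fromℕ (suc n)
rest-lower  : ∀ {n β ρ} → CNF (ω^ β ∔ ρ) → height β ℕ.≤ n →
              value n β + ½^ (gapExp (suc n) ρ) ≤ value (suc n) ρ
rest-upper  : ∀ {n β ρ} → CNF (ω^ β ∔ ρ) → height β ℕ.≤ n →
              value (suc n) ρ < value n β + 1ℚ
-- Fusions starting from `value n β` itself would stop `½^ (gapExp n β)` short of `value n β + 1`.
-- The rest starts higher by the margin of `rest-lower`, which the fusions scale down.
node-lower  : ∀ {n β ρ} → CNF (ω^ β ∔ ρ) → height β ℕ.≤ n →
              value n β + 1ℚ + ½^ (gapExp (suc n) (ω^ β ∔ ρ)) ≤
              value (suc n) (ω^ β ∔ ρ) + ½^ (gapExp n β)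
node-upper  : ∀ {n β ρ} → CNF (ω^ β ∔ ρ) → height β ℕ.≤ n →
              value (suc n) (ω^ β ∔ ρ) < value n β + 1ℚ
value-gap   : ∀ {n t u} → CNF t → CNF u → height u ℕ.≤ n → t ≺ u →
              value n t + ½^ (gapExp n u) ≤ value n u

-- Here `x` will be `bottom (suc n)`, or the ceiling `value n α + 1` of a smaller exponent `α`. The
-- term `½^ (gapExp n β)` cancels against `node-lower`.
node-gap : ∀ {n β ρ} x → CNF (ω^ β ∔ ρ) → height β ℕ.≤ n →
           x + ½^ (gapExp n β) ≤ value n β + 1ℚ →
           x + ½^ (gapExp (suc n) (ω^ β ∔ ρ)) ≤ value (suc n) (ω^ β ∔ ρ)
node-gap {n} {β} {ρ} x c h x≤ = ≤-shift (+-mono-≤ x≤ (node-lower c h))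
  (solve 5 (λ x w s v u → v := s :+ (v :+ w) :+ (x :+ u :- (x :+ w :+ (s :+ u)))) refl
    x (½^ (gapExp n β)) (value n β + 1ℚ) (value (suc n) (ω^ β ∔ ρ))
    (½^ (gapExp (suc n) (ω^ β ∔ ρ))))

-- Equality holds here, which explains the exponent `suc (suc n)` given to `𝟎`.
value-lower {n}     {𝟎}        c h       = ≤-reflexive (bottom-suc n)
value-lower {suc n} {ω^ β ∔ ρ} c (s≤s h) = ≤-trans
  (+-monoˡ-≤ _ (<⇒≤ (gap⇒< (3 ℕ.+ n) {bottom (suc (suc n))} (≤-reflexive (bottom-suc (suc n))))))
  (≤-shift (node-gap (bottom (suc n)) c h (value-lower (CNF-exponent c) h))
    (solve 3 (λ b w v → v :+ con 1ℚ := v :+ (b :+ con 1ℚ :+ w :- (b :+ w))) refl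
      (bottom (suc n)) (½^ (gapExp (suc n) (ω^ β ∔ ρ))) (value (suc n) (ω^ β ∔ ρ))))

value-upper {n}     {𝟎}        c h       = bottom-< n
value-upper {suc n} {ω^ β ∔ ρ} c (s≤s h) =
  <-trans (node-upper c h) (+-monoˡ-< 1ℚ (value-upper (CNF-exponent c) h))

rest-lower {n} {β} {ρ} c h = ≤-shift
  (≤-trans (+-monoˡ-≤ _ (<⇒≤ (<-trans (+-monoˡ-< 1ℚ (value-upper (CNF-exponent c) h))
                                      (fromℕ<bottom (suc (suc n))))))
           (value-lower (CNF-rest c) (height-rest c h)))
  (solve 3 (λ s w v → v := v :+ con 1ℚ :+ (s :+ w :- (s :+ con 1ℚ :+ w))) refl
    (value n β) (½^ (gapExp (suc n) ρ)) (value (suc n) ρ))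

-- The order of exponents enters here: a nonempty rest lies below the ceiling of its own leading
-- exponent, which is at most `β`.
rest-upper {n} {β} (single cβ) h = gap⇒< (gapExp n β) (value-lower cβ h)
rest-upper {n} {β} {ω^ γ ∔ _} (cons cβ cρ (inj₁ γ≺β)) h = <-trans
  (node-upper cρ (ℕₚ.≤-trans (height-mono γ≺β) h))
  (+-monoˡ-< 1ℚ (gap⇒< (gapExp n β) {value n γ} (value-gap (CNF-exponent cρ) cβ h γ≺β)))
rest-upper (cons cβ cρ (inj₂ refl)) h = node-upper cρ h

node-lower {n} {β} {ρ} c h = ≤-shift
  (approach-gap (gapExp n β) {gapExp (suc n) ρ} {value n β} (rest-lower c h))
  (trans
    (solve 4 (λ a k w v → v :+ k := v :+ (a :+ k :+ w :- (a :+ w))) refl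
      (approach (gapExp n β) (value n β) (value n β)) (½^ (gapExp n β))
      (½^ (gapExp (suc n) (ω^ β ∔ ρ))) (value (suc n) (ω^ β ∔ ρ)))
    (cong (λ z → value (suc n) (ω^ β ∔ ρ) + (z + ½^ (gapExp (suc n) (ω^ β ∔ ρ))
             - (approach (gapExp n β) (value n β) (value n β) + ½^ (gapExp (suc n) (ω^ β ∔ ρ)))))
      (approach-self (gapExp n β) (value n β))))

node-upper {n} {β} c h = approach-< (gapExp n β) (rest-upper c h)

value-gap {suc n} ct cu (s≤s h) 𝟎≺ = node-gap (bottom (suc n)) cu h (value-lower (CNF-exponent cu) h)
value-gap {suc n} {ω^ α ∔ _} {ω^ γ ∔ δ} ct cu (s≤s h) (head α≺γ) = ≤-trans
  (+-monoˡ-≤ _ (<⇒≤ (node-upper ct (ℕₚ.≤-trans (height-mono α≺γ) h))))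
  (node-gap (value n α + 1ℚ) cu h (≤-shift (value-gap (CNF-exponent ct) (CNF-exponent cu) h α≺γ)
    (solve 3 (λ a w c → c :+ con 1ℚ := c :+ (a :+ con 1ℚ :+ w :- (a :+ w))) refl
      (value n α) (½^ (gapExp n γ)) (value n γ))))
-- With equal exponents both rests undergo the same fusions, which shrink their gap by
-- `½^ (gapExp n α)`; hence the sum in `gapExp`.
value-gap {suc n} {ω^ α ∔ _} {ω^ α ∔ _} ct cu (s≤s h) (tail β≺δ) =
  approach-gap (gapExp n α)
    (value-gap (CNF-rest ct) (CNF-rest cu) (height-rest cu h) β≺δ)

-- The embedding into the fusible numbers.

value-fusible : ∀ {n t} → CNF t → height t ℕ.≤ n → Fusible (value n t)
value-fusible {n}     {𝟎}        c h       = bottom-fusible n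
value-fusible {suc n} {ω^ β ∔ ρ} c (s≤s h) = approach-fusible (gapExp n β)
  (value-fusible (CNF-exponent c) h) (value-fusible (CNF-rest c) (height-rest c h))
  (<⇒≤ (gap⇒< (gapExp (suc n) ρ) (rest-lower c h))) (rest-upper c h)

value-> : ∀ {n t} → CNF t → height t ℕ.≤ n → fromℕ n < value n t
value-> {n} {t} c h = <-shift
  (<-trans (fromℕ<bottom (suc n)) (gap⇒< (gapExp n t) (value-lower c h)))
  (solve 2 (λ x v → v := v :+ con 1ℚ :+ (x :- (x :+ con 1ℚ))) refl (fromℕ n) (value n t))

-- Each term is placed at the level of its own height. Different heights are separated by an
-- integer; equal heights are handled by `value-gap`.
value-mono : ∀ {t u} → CNF t → CNF u → t ≺ u → value (height t) t < value (height u) u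
value-mono {t} {u} ct cu t≺u with ℕₚ.m≤n⇒m<n∨m≡n (height-mono t≺u)
... | inj₁ ht<hu = <-trans (<-≤-trans (value-upper ct ℕₚ.≤-refl) (fromℕ-mono ht<hu))
                           (value-> cu ℕₚ.≤-refl)
... | inj₂ ht≡hu = subst (λ n → value n t < value (height u) u) (sym ht≡hu)
                     (gap⇒< (gapExp (height u) u) (value-gap ct cu ℕₚ.≤-refl t≺u))

-- By trichotomy in `A`, a failure of injectivity or of order reflection would contradict strict
-- monotonicity.
strictMono⇒≼ : ∀ {a₁ a₂ a₃ b₁ b₂ b₃}
  (A : StrictTotalOrder a₁ a₂ a₃) (B : StrictTotalOrder b₁ b₂ b₃) →
  let module A = StrictTotalOrder A; module B = StrictTotalOrder B in
  (f : A.Carrier → B.Carrier) →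
  (∀ {x y} → x A.≈ y → f x B.≈ f y) → (∀ {x y} → x A.< y → f x B.< f y) → A ≼ B
strictMono⇒≼ A B f cong′ mono′ = f , record
  { isOrderHomomorphism = record { cong = cong′ ; mono = mono′ }
  ; injective = λ {x} {y} fx≈fy → case A.compare x y of λ where
      (tri< x<y _ _) → contradiction (mono′ x<y) (B.irrefl fx≈fy)
      (tri≈ _ x≈y _) → x≈y
      (tri> _ _ y<x) → contradiction (mono′ y<x) (B.irrefl (B.Eq.sym fx≈fy))
  ; cancel = λ {x} {y} fx<fy → case A.compare x y of λ where
      (tri< x<y _ _) → x<y
      (tri≈ _ x≈y _) → contradiction fx<fy (B.irrefl (cong′ x≈y))
      (tri> _ _ y<x) → contradiction fx<fy (B.asym (mono′ y<x))
  }
  where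
  module A = StrictTotalOrder A
  module B = StrictTotalOrder B

mainTheorem4 : ε₀ ≼ 𝓕
mainTheorem4 = strictMono⇒≼ ε₀ 𝓕
  (λ (t , ct) → value (height t) t , value-fusible ct ℕₚ.≤-refl)
  (cong (λ t → value (height t) t))
  (λ {(_ , ct)} {(_ , cu)} → value-mono ct cu)
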